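{- Let $X$ be a connected graph. Then there exists a constant $C_X$ such that every connected $X$-free graph $G$ (of order at least $3$) satisfies $rx_3(G)\leq sdiam_3(G)+C_X$ if and only if $X=P_3$.
   Context: All graphs are finite, simple, undirected. An edge-coloring of $G$ assigns colors to edges (adjacent edges may share a color). A tree in an edge-colored graph is rainbow if no two of its edges have the same color. For $S\subseteq V(G)$, an $S$-tree is a tree in $G$ containing all vertices of $S$. A $k$-rainbow coloring of a connected graph $G$ is an edge-coloring such that for every set $S$ of $k$ vertices there is a rainbow $S$-tree; $rx_k(G)$, the $k$-rainbow index, is the minimum number of colors in a $k$-rainbow coloring of $G$ (defined for connected $G$ with at least $k$ vertices). The Steiner distance $d(S)$ of $S\subseteq V(G)$ is the minimum number of edges of an $S$-tree; the $k$-Steiner diameter $sdiam_k(G)$ is the maximum of $d(S)$ over all $k$-element $S\subseteq V(G)$. For a family $\mathcal{F}$ of graphs, $G$ is $\mathcal{F}$-free if $G$ contains no induced subgraph isomorphic to a member of $\mathcal{F}$; $X$-free means $\{X\}$-free. $P_n$ is the path on $n$ vertices.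
   Formalization: X is additionally required to have at least 3 vertices; for X = K_1 or K_2 no connected graph of order at least 3 is X-free, so the bound holds vacuously although X is not P_3. -}

module Defs where

open import Data.Bool.Base using (Bool; T)
open import Data.Bool.Properties using (T?)
open import Data.Fin.Base using (Fin; toℕ)
open import Data.Fin.Properties using (_<?_)
open import Data.Fin.Subset using (Subset; _∈_; _⊆_; ∣_∣; Nonempty)
open import Data.List.Base using (List; _∷_; _∷ʳ_; length; filter; allFin; cartesianProduct)
open import Data.List.Relation.Unary.Linked using (Linked)
open import Data.List.Relation.Unary.Unique.Propositional using (Unique)
open import Data.Nat.Base using (ℕ; suc; _≤_)
open import Data.Nat.Properties using (_≟_; 1+n≢n)
open import Data.Product using (Σ; ∃; _×_; _,_)
open import Data.Sum using (_⊎_; inj₁; inj₂; swap; reduce)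
open import Function.Bundles using (_⇔_; _↔_; Inverse)
open import Function.Definitions using (Injective)
open import Level using (0ℓ)
open import Relation.Binary.Core using (Rel)
open import Relation.Binary.Construct.Closure.ReflexiveTransitive using (Star)
open import Relation.Binary.PropositionalEquality using (_≡_)
open import Relation.Nullary using (¬_; Dec)
open import Relation.Nullary.Decidable using (⌊_⌋; toWitness; fromWitness; _×-dec_; _⊎-dec_)

record Graph : Set where
  field
    order  : ℕ
    adj    : Fin order → Fin order → Bool
    sym    : ∀ u v → T (adj u v) → T (adj v u)
    irrefl : ∀ v → ¬ T (adj v v)

  Vertex : Set
  Vertex = Fin order

  infix 4 _~_
  _~_ : Rel Vertex 0ℓ
  u ~ v = T (adj u v)

open Graph public using (order; Vertex)

-- The null graph is not connected.
Connected : Graph → Set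
Connected G = Vertex G × (∀ u v → Star (Graph._~_ G) u v)

infix 4 _≅_
_≅_ : Graph → Graph → Set
G ≅ H = Σ (Vertex G ↔ Vertex H) λ φ →
  ∀ u v → (u ~ᴳ v) ⇔ (Inverse.to φ u ~ᴴ Inverse.to φ v)
  where
  open Graph G using () renaming (_~_ to _~ᴳ_)
  open Graph H using () renaming (_~_ to _~ᴴ_)

-- An isomorphism of X onto the subgraph of G induced by the image of f.
ContainsInduced : Graph → Graph → Set
ContainsInduced G X = Σ (Vertex X → Vertex G) λ f →
  Injective _≡_ _≡_ f × (∀ u v → (u ~ˣ v) ⇔ (f u ~ᴳ f v))
  where
  open Graph G using () renaming (_~_ to _~ᴳ_)
  open Graph X using () renaming (_~_ to _~ˣ_)

infix 4 _-Free_
_-Free_ : Graph → Graph → Set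
X -Free G = ¬ ContainsInduced G X

Path : ℕ → Graph
Path n = record
  { order  = n
  ; adj    = λ u v → ⌊ consecutive? u v ⌋
  ; sym    = λ u v p → fromWitness {a? = consecutive? v u}
                         (swap (toWitness {a? = consecutive? u v} p))
  ; irrefl = λ v p → 1+n≢n (reduce (toWitness {a? = consecutive? v v} p))
  }
  where
  consecutive? : (u v : Fin n) → Dec (suc (toℕ u) ≡ toℕ v ⊎ suc (toℕ v) ≡ toℕ u)
  consecutive? u v = (suc (toℕ u) ≟ toℕ v) ⊎-dec (suc (toℕ v) ≟ toℕ u)

-- A cycle is a closed walk x, y₁, …, yₘ, x with m ≥ 2 and x, y₁, …, yₘ distinct.
Acyclic : {A : Set} → Rel A 0ℓ → Set
Acyclic {A} _~_ = ∀ (x : A) (ys : List A) → 2 ≤ length ys → Unique (x ∷ ys) →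
  ¬ Linked _~_ (x ∷ (ys ∷ʳ x))

record Subgraph (G : Graph) : Set where
  open Graph G using (_~_)
  field
    vertices : Subset (order G)
    edge     : Vertex G → Vertex G → Bool
    edge-sym : ∀ u v → T (edge u v) → T (edge v u)
    edge⇒~   : ∀ u v → T (edge u v) → u ~ v
    edge⇒∈   : ∀ u v → T (edge u v) → u ∈ vertices

  Edge : Rel (Vertex G) 0ℓ
  Edge u v = T (edge u v)

  -- Each edge is counted once, as the pair (u , v) with u < v.
  size : ℕ
  size = length (filter (λ (u , v) → (u <? v) ×-dec T? (edge u v))
                        (cartesianProduct (allFin (order G)) (allFin (order G))))

  IsTree : Set
  IsTree = Nonempty vertices
         × (∀ u v → u ∈ vertices → v ∈ vertices → Star Edge u v)
         × Acyclic Edge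

IsSTree : (G : Graph) → Subset (order G) → Subgraph G → Set
IsSTree G S H = IsTree × S ⊆ vertices
  where open Subgraph H

record EdgeColoring (G : Graph) (m : ℕ) : Set where
  open Graph G using (_~_)
  field
    color     : ∀ u v → u ~ v → Fin m
    color-sym : ∀ u v (p : u ~ v) (q : v ~ u) → color u v p ≡ color v u q

Rainbow : {G : Graph} {m : ℕ} → EdgeColoring G m → Subgraph G → Set
Rainbow c H = ∀ u v x y (p : Edge u v) (q : Edge x y) →
  color u v (edge⇒~ u v p) ≡ color x y (edge⇒~ x y q) →
  (u ≡ x × v ≡ y) ⊎ (u ≡ y × v ≡ x)
  where
  open EdgeColoring c
  open Subgraph H

IsRainbowColoring : (k : ℕ) {G : Graph} {m : ℕ} → EdgeColoring G m → Set
IsRainbowColoring k {G} c = ∀ (S : Subset (order G)) → ∣ S ∣ ≡ k →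
  ∃ λ (H : Subgraph G) → IsSTree G S H × Rainbow c H

IsMinimum : (ℕ → Set) → ℕ → Set
IsMinimum P n = P n × (∀ m → P m → n ≤ m)

IsMaximum : (ℕ → Set) → ℕ → Set
IsMaximum P n = P n × (∀ m → P m → m ≤ n)

-- IsRainbowIndex k G r: rx_k(G) = r. Colorings need not use every one of the
-- m available colors, which does not affect the minimum.
IsRainbowIndex : ℕ → Graph → ℕ → Set
IsRainbowIndex k G =
  IsMinimum (λ m → ∃ λ (c : EdgeColoring G m) → IsRainbowColoring k c)

-- IsSteinerDistance G S d: d(S) = d.
IsSteinerDistance : (G : Graph) → Subset (order G) → ℕ → Set
IsSteinerDistance G S =
  IsMinimum (λ d → ∃ λ (H : Subgraph G) → IsSTree G S H × Subgraph.size H ≡ d)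

-- IsSteinerDiameter k G s: sdiam_k(G) = s.
IsSteinerDiameter : ℕ → Graph → ℕ → Set
IsSteinerDiameter k G =
  IsMaximum (λ d → ∃ λ (S : Subset (order G)) → ∣ S ∣ ≡ k × IsSteinerDistance G S d)

{-# OPTIONS --safe #-}

-- A connected P₃-free graph is complete, and a complete graph has a 3-rainbow
-- colouring with five colours, whatever its order.
--
-- Conversely, let G be a clique with n pendant vertices attached to it. Two pendant
-- edges lie in every tree containing their leaves, so they need different colours and
-- rx₃(G) ≥ n; on the other hand sdiam₃(G) is bounded independently of n. Hence X must
-- be an induced subgraph of every such G with n large. The clique of order one gives
-- stars, so X is a star; the clique with one pendant vertex at each of its vertices
-- is claw-free, so X has only two leaves.
--
-- Being isomorphic to P₃ is a decidable property, so the argument only needs rx₃(G),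
-- sdiam₃(G) and the embeddings of X to exist up to double negation.
module Submission where

open import Defs
open import Data.Bool.Base using (Bool; T; false)
open import Data.Bool.Properties using (T?; T-irrelevant)
open import Data.Empty using (⊥; ⊥-elim)
open import Data.Fin.Base using (Fin; zero; suc; toℕ; fromℕ<; combine; _↑ˡ_; _↑ʳ_; splitAt; punchIn)
open import Data.Fin.Patterns using (0F; 1F; 2F; 3F; 4F)
open import Data.Fin.Permutation using (transpose; _⟨$⟩ʳ_)
import Data.Fin.Properties as Fin
open import Data.Fin.Subset as Subset using (Subset; ⁅_⁆; _∪_; ∣_∣; inside; outside)
import Data.Fin.Subset.Properties as Subset
open import Data.List.Base using (List; []; _∷_; _∷ʳ_; length; map; allFin; cartesianProduct; lookup)
open import Data.List.Membership.Propositional using (_∈_)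
open import Data.List.Membership.Propositional.Properties using (∈-map⁺; ∈-++⁺ˡ; ∈-++⁺ʳ; ∈-filter⁻; ∈-lookup)
open import Data.List.Properties using (length-map; length-++)
open import Data.List.Relation.Unary.All as All using (All; []; _∷_)
import Data.List.Relation.Unary.All.Properties as AllP
open import Data.List.Relation.Unary.Any as Any using (here; there)
import Data.List.Relation.Unary.Any.Properties as Any
open import Data.List.Relation.Unary.Linked as Linked using (Linked; []; [-]; _∷_)
open import Data.List.Relation.Unary.Unique.Propositional using (Unique; []; _∷_)
import Data.List.Relation.Unary.Unique.Propositional.Properties as Unique
open import Data.Nat.Base using (ℕ; zero; suc; _≤_; _<_; _+_; _*_; _∸_; _⊓_; _⊔_; z≤n; s≤s)
open import Data.Nat.Induction using (<-rec)
import Data.Nat.Properties as ℕ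
open import Data.Product using (∃; _×_; _,_; proj₁; proj₂; swap; uncurry)
open import Data.Product.Properties using (≡-dec; ,-injective)
open import Data.Sum as Sum using (_⊎_; inj₁; inj₂; [_,_]′)
import Data.Vec.Base as Vec
open import Data.Vec.Base using ([]; _∷_)
open import Function.Base using (_∘_; id; case_of_; const)
open import Function.Bundles using (_⇔_; _↔_; mk⇔; Equivalence; Injection; Inverse)
open import Function.Construct.Composition using (_⇔-∘_)
open import Function.Properties.Inverse using (↔⇒↣; ↔-sym)
open import Level using (0ℓ)
import Relation.Binary.Construct.Closure.ReflexiveTransitive as Star
open import Relation.Binary.Construct.Closure.ReflexiveTransitive using (Star; ε; _◅_; _◅◅_)
open import Relation.Binary.Core using (Rel)
open import Relation.Binary.Definitions using (DecidableEquality; Symmetric)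
open import Relation.Binary.PropositionalEquality using (_≡_; _≢_; refl; sym; trans; cong; cong₂; subst; subst₂)
open import Relation.Nullary using (¬_; Dec; yes; no; contradiction)
open import Relation.Nullary.Decidable using (⌊_⌋; toWitness; fromWitness; decidable-stable; _⊎-dec_; _×-dec_; _→-dec_; ¬?)

-- Minima and maxima up to double negation.

-- If no minimum existed, strong induction would refute `P` at every number. The double negation
-- replaces a decision procedure for `P`, which in the applications quantifies over colourings or
-- subgraphs.
¬¬-minimum : (P : ℕ → Set) → ∀ {n} → P n → ¬ ¬ ∃ (IsMinimum P)
¬¬-minimum P Pn none = <-rec (λ n → ¬ P n) step _ Pn
  where
  step : ∀ n → (∀ {m} → m < n → ¬ P m) → ¬ P n
  step n smaller Pn = none (n , Pn , λ m Pm → ℕ.≮⇒≥ λ m<n → smaller m<n Pm)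

-- Induction on the gap `b ∸ n`: a larger witness has a strictly smaller gap, because `bound` keeps
-- it at most `b`.
¬¬-maximum : (P : ℕ → Set) → ∀ b → (∀ m → P m → m ≤ b) →
             ∀ {n} → P n → ¬ ¬ ∃ (IsMaximum P)
¬¬-maximum P b bound {n} Pn none =
  <-rec (λ k → ∀ n → b ∸ n ≡ k → ¬ P n) step _ n refl Pn
  where
  step : ∀ k → (∀ {j} → j < k → ∀ n → b ∸ n ≡ j → ¬ P n) → ∀ n → b ∸ n ≡ k → ¬ P n
  step _ closer n refl Pn = none (n , Pn , λ m Pm → ℕ.≮⇒≥ λ n<m →
    closer (ℕ.∸-monoʳ-< n<m (bound m Pm)) m refl Pm)

-- Finite lists and subsets

lookup-injective : {A : Set} {xs : List A} → Unique xs →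
                   ∀ {i j} → lookup xs i ≡ lookup xs j → i ≡ j
lookup-injective (_  ∷ _) {zero}  {zero}  _  = refl
lookup-injective (x∉ ∷ _) {zero}  {suc j} eq = contradiction eq (All.lookup x∉ (∈-lookup j))
lookup-injective (x∉ ∷ _) {suc i} {zero}  eq = contradiction (sym eq) (All.lookup x∉ (∈-lookup i))
lookup-injective (_  ∷ u) {suc i} {suc j} eq = cong suc (lookup-injective u eq)

-- Pigeonhole principle on positions: an entry of `xs` is sent to its place in `ys`, and looking it
-- up again recovers it, so the map is injective.
unique-⊆⇒length≤ : {A : Set} {xs ys : List A} → Unique xs →
                   (∀ {x} → x ∈ xs → x ∈ ys) → length xs ≤ length ys
unique-⊆⇒length≤ {xs = xs} {ys} u sub = Fin.injective⇒≤ {f = position} λ {i} {j} eq →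
  lookup-injective u (trans (lookup-position i)
    (trans (cong (lookup ys) eq) (sym (lookup-position j))))
  where
  position : Fin (length xs) → Fin (length ys)
  position i = Any.index (sub (∈-lookup i))

  lookup-position : ∀ i → lookup xs i ≡ lookup ys (position i)
  lookup-position i = Any.lookup-index (sub (∈-lookup i))

-- Rainbow trees are certified by a duplicate-free list of colours; this recovers an edge of the
-- tree from its colour.
unique-map⇒injectiveOn : {A B : Set} (f : A → B) {xs : List A} → Unique (map f xs) →
                         ∀ {x y} → x ∈ xs → y ∈ xs → f x ≡ f y → x ≡ y
unique-map⇒injectiveOn f (_  ∷ _) (here refl) (here refl) _  = refl
unique-map⇒injectiveOn f (x∉ ∷ _) (here refl) (there y∈)  eq =
  contradiction eq (All.lookup x∉ (∈-map⁺ f y∈))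
unique-map⇒injectiveOn f (x∉ ∷ _) (there x∈)  (here refl) eq =
  contradiction (sym eq) (All.lookup x∉ (∈-map⁺ f x∈))
unique-map⇒injectiveOn f (_  ∷ u) (there x∈)  (there y∈)  eq =
  unique-map⇒injectiveOn f u x∈ y∈ eq

fromℕ<-distinct : ∀ {n i j} → i ≢ j → .(i<n : i < n) .(j<n : j < n) → fromℕ< i<n ≢ fromℕ< j<n
fromℕ<-distinct i≢j i<n j<n eq = i≢j (Fin.fromℕ<-injective _ _ i<n j<n eq)

elements : ∀ {n} → Subset n → List (Fin n)
elements []            = []
elements (inside  ∷ p) = zero ∷ map suc (elements p)
elements (outside ∷ p) = map suc (elements p)

length-elements : ∀ {n} (p : Subset n) → length (elements p) ≡ ∣ p ∣
length-elements []            = refl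
length-elements (inside  ∷ p) = cong suc (trans (length-map suc (elements p)) (length-elements p))
length-elements (outside ∷ p) = trans (length-map suc (elements p)) (length-elements p)

∈-elements : ∀ {n} {p : Subset n} {x} → x Subset.∈ p → x ∈ elements p
∈-elements {p = inside  ∷ p} Vec.here        = here refl
∈-elements {p = inside  ∷ p} (Vec.there x∈p) = there (∈-map⁺ suc (∈-elements x∈p))
∈-elements {p = outside ∷ p} (Vec.there x∈p) = ∈-map⁺ suc (∈-elements x∈p)

∣p∣≡3⇒covered : ∀ {n} (p : Subset n) → ∣ p ∣ ≡ 3 →
                ∃ λ x → ∃ λ y → ∃ λ z → ∀ {u} → u Subset.∈ p → u ∈ x ∷ y ∷ z ∷ []
∣p∣≡3⇒covered p ∣p∣≡3 with elements p | length-elements p | ∈-elements {p = p}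
... | x ∷ y ∷ z ∷ []        | _     | cover = x , y , z , cover
... | []                    | 0≡∣p∣ | _ with () ← trans 0≡∣p∣ ∣p∣≡3
... | _ ∷ []                | 1≡∣p∣ | _ with () ← trans 1≡∣p∣ ∣p∣≡3
... | _ ∷ _ ∷ []            | 2≡∣p∣ | _ with () ← trans 2≡∣p∣ ∣p∣≡3
... | _ ∷ _ ∷ _ ∷ _ ∷ _     | 4≤∣p∣ | _ with () ← trans 4≤∣p∣ ∣p∣≡3

∣⁅x⁆∪p∣≡1+∣p∣ : ∀ {n} (x : Fin n) (p : Subset n) → x Subset.∉ p → ∣ ⁅ x ⁆ ∪ p ∣ ≡ suc ∣ p ∣
∣⁅x⁆∪p∣≡1+∣p∣ zero    (inside  ∷ p) 0∉p = contradiction Vec.here 0∉p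
∣⁅x⁆∪p∣≡1+∣p∣ zero    (outside ∷ p) 0∉p = cong (suc ∘ ∣_∣) (Subset.∪-identityˡ p)
∣⁅x⁆∪p∣≡1+∣p∣ (suc x) (inside  ∷ p) x∉p = cong suc (∣⁅x⁆∪p∣≡1+∣p∣ x p (x∉p ∘ Vec.there))
∣⁅x⁆∪p∣≡1+∣p∣ (suc x) (outside ∷ p) x∉p = ∣⁅x⁆∪p∣≡1+∣p∣ x p (x∉p ∘ Vec.there)

triple : ∀ {n} → Fin n → Fin n → Fin n → Subset n
triple x y z = ⁅ x ⁆ ∪ (⁅ y ⁆ ∪ ⁅ z ⁆)

∣triple∣≡3 : ∀ {n} {x y z : Fin n} → x ≢ y → x ≢ z → y ≢ z → ∣ triple x y z ∣ ≡ 3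
∣triple∣≡3 {x = x} {y} {z} x≢y x≢z y≢z =
  trans (∣⁅x⁆∪p∣≡1+∣p∣ x _ λ x∈ → [ x≢y ∘ Subset.x∈⁅y⁆⇒x≡y y , x≢z ∘ Subset.x∈⁅y⁆⇒x≡y z ]′
                                    (Subset.x∈p∪q⁻ _ _ x∈))
 (cong suc (trans (∣⁅x⁆∪p∣≡1+∣p∣ y _ (y≢z ∘ Subset.x∈⁅y⁆⇒x≡y z)) (cong suc (Subset.∣⁅x⁆∣≡1 z))))

-- Trees grown by adding leaves

-- Supplies the predecessor of the base point on a closed walk, that is, its second neighbour on the
-- cycle.
last-edge : {A : Set} {R : Rel A 0ℓ} {a x : A} (bs : List A) →
            Linked R (a ∷ (bs ∷ʳ x)) → ∃ λ z → z ∈ a ∷ bs × R z x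
last-edge []       (Rax ∷ _) = _ , here refl , Rax
last-edge (b ∷ bs) (_ ∷ Rs)  with z , z∈ , Rzx ← last-edge bs Rs = z , there z∈ , Rzx

-- A cycle through a vertex visits two distinct neighbours of it, so no cycle
-- passes through a vertex v of degree one.
module _ {A : Set} (_≟_ : DecidableEquality A) {R R′ : Rel A 0ℓ} (v p : A)
         (R′-sym : Symmetric R′)
         (leaf : ∀ {b} → R′ v b → b ≡ p)
         (rest : ∀ {a b} → a ≢ v → b ≢ v → R′ a b → R a b) where

  avoid-leaf : ∀ {a x} bs → a ≢ v → x ≢ v → Unique (a ∷ (bs ∷ʳ x)) →
               Linked R′ (a ∷ (bs ∷ʳ x)) → Linked R (a ∷ (bs ∷ʳ x))
  avoid-leaf []       a≢v x≢v u         (Rax ∷ [-]) = rest a≢v x≢v Rax ∷ [-]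
  avoid-leaf (b ∷ bs) a≢v x≢v (a∉ ∷ u) (Rab ∷ Rs)  with b ≟ v
  ... | no  b≢v = rest a≢v b≢v Rab ∷ avoid-leaf bs b≢v x≢v u Rs
  -- The leaf is interior to the walk, so its predecessor and successor both equal `p`. The
  -- successor is the endpoint `x` here and `c` in the next clause.
  avoid-leaf (b ∷ [])     a≢v x≢v ((_ ∷ a≢x ∷ _) ∷ u) (Rav ∷ Rvx ∷ Rs) | yes refl =
    contradiction (trans (leaf (R′-sym Rav)) (sym (leaf Rvx))) a≢x
  avoid-leaf (b ∷ c ∷ bs) a≢v x≢v ((_ ∷ a≢c ∷ _) ∷ u) (Rav ∷ Rvc ∷ Rs) | yes refl =
    contradiction (trans (leaf (R′-sym Rav)) (sym (leaf Rvc))) a≢c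

  acyclic-leaf : Acyclic R → Acyclic R′
  acyclic-leaf acyclic x (y ∷ [])      (s≤s ())
  acyclic-leaf acyclic x (y ∷ y′ ∷ zs) 2≤ u@((x≢y ∷ x≢y′ ∷ x∉) ∷ u′@(y∉ ∷ _)) (Rxy ∷ Rs)
    with x ≟ v
  -- The leaf is the base point: its successor `y` and its predecessor `z` both equal `p`, yet `z`
  -- lies in `y′ ∷ zs`, which avoids `y`.
  ... | yes refl with z , z∈ , Rzx ← last-edge zs (Linked.tail Rs) =
    All.lookup y∉ z∈ (trans (leaf Rxy) (sym (leaf (R′-sym Rzx))))
  ... | no x≢v with y ≟ v | Rs
  ...   | yes refl | Rvy′ ∷ _ = x≢y′ (trans (leaf (R′-sym Rxy)) (sym (leaf Rvy′)))
  ...   | no y≢v   | _        = acyclic x (y ∷ y′ ∷ zs) 2≤ u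
    (rest x≢v y≢v Rxy ∷ avoid-leaf (y′ ∷ zs) y≢v x≢v rotated Rs)
    where
    -- The cycle lists `x` at its front, whereas `avoid-leaf` expects it at the far end.
    rotated : Unique (y ∷ y′ ∷ zs ∷ʳ x)
    rotated = Unique.++⁺ u′ ([] ∷ [])
      λ { (w∈ , here refl) → All.lookup (x≢y ∷ x≢y′ ∷ x∉) w∈ refl }

module _ (G : Graph) where
  open Graph G using (_~_)
  private
    V = Vertex G

  infix 4 _∣_joins_
  -- Each edge is listed once, as a new leaf followed by its parent. Connectedness and acyclicity
  -- become inductions on the last leaf, and the edge list can be measured and mapped to colours.
  data GrownTree : Subset (order G) → List (V × V) → Set where
    root : ∀ r → GrownTree ⁅ r ⁆ []
    grow : ∀ {vs es v p} → GrownTree vs es → v Subset.∉ vs → p Subset.∈ vs → v ~ p →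
           GrownTree (⁅ v ⁆ ∪ vs) ((v , p) ∷ es)

  _∣_joins_ : List (V × V) → V → V → Set
  _∣_joins_ es u v = (u , v) ∈ es ⊎ (v , u) ∈ es

  joins? : ∀ es u v → Dec (es ∣ u joins v)
  joins? es u v = ((u , v) ∈? es) ⊎-dec ((v , u) ∈? es)
    where open import Data.List.Membership.DecPropositional (≡-dec Fin._≟_ Fin._≟_) using (_∈?_)

  ∈-tail : ∀ {v p a b : V} {es} → (a , b) ≢ (v , p) → (a , b) ∈ (v , p) ∷ es → (a , b) ∈ es
  ∈-tail ≢ (here eq)  = contradiction eq ≢
  ∈-tail ≢ (there ∈es) = ∈es

  edges⊆vertices : ∀ {vs es} → GrownTree vs es → ∀ {u v} → (u , v) ∈ es → u Subset.∈ vs × v Subset.∈ vs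
  edges⊆vertices (grow t v∉ p∈ v~p) (here refl) =
    Subset.x∈p∪q⁺ (inj₁ (Subset.x∈⁅x⁆ _)) , Subset.x∈p∪q⁺ (inj₂ p∈)
  edges⊆vertices (grow t v∉ p∈ v~p) (there e∈) with u∈ , v∈ ← edges⊆vertices t e∈ =
    Subset.x∈p∪q⁺ (inj₂ u∈) , Subset.x∈p∪q⁺ (inj₂ v∈)

  edges⊆~ : ∀ {vs es} → GrownTree vs es → ∀ {u v} → (u , v) ∈ es → u ~ v
  edges⊆~ (grow t v∉ p∈ v~p) (here refl) = v~p
  edges⊆~ (grow t v∉ p∈ v~p) (there e∈)  = edges⊆~ t e∈

  grown-nonempty : ∀ {vs es} → GrownTree vs es → Subset.Nonempty vs
  grown-nonempty (root r)       = r , Subset.x∈⁅x⁆ r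
  grown-nonempty (grow t _ _ _) = _ , Subset.x∈p∪q⁺ (inj₁ (Subset.x∈⁅x⁆ _))

  grown-connected : ∀ {vs es} → GrownTree vs es → ∀ {u v} → u Subset.∈ vs → v Subset.∈ vs →
                    Star (es ∣_joins_) u v
  grown-connected (root r) u∈ v∈
    with refl ← Subset.x∈⁅y⁆⇒x≡y r u∈ | refl ← Subset.x∈⁅y⁆⇒x≡y r v∈ = ε
  grown-connected (grow {vs} {es} {w} {p} t _ p∈ _) {u} {v} u∈ v∈ =
    -- All walks are routed through `p`, the parent of the newest leaf.
    to-p u∈ ◅◅ Star.reverse Sum.swap (to-p v∈)
    where
    to-p : ∀ {u} → u Subset.∈ ⁅ w ⁆ ∪ vs → Star ((w , p) ∷ es ∣_joins_) u p
    to-p u∈ with Subset.x∈p∪q⁻ ⁅ w ⁆ vs u∈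
    ... | inj₁ u∈⁅w⁆ with refl ← Subset.x∈⁅y⁆⇒x≡y w u∈⁅w⁆ = inj₁ (here refl) ◅ ε
    ... | inj₂ u∈vs = Star.map (Sum.map there there) (grown-connected t u∈vs p∈)

  grown-acyclic : ∀ {vs es} → GrownTree vs es → Acyclic (es ∣_joins_)
  grown-acyclic (root r) x (y ∷ ys) _ _ (inj₁ () ∷ _)
  grown-acyclic (root r) x (y ∷ ys) _ _ (inj₂ () ∷ _)
  grown-acyclic (grow {vs} {es} {w} {p} t w∉ p∈ _) =
    acyclic-leaf Fin._≟_ w p Sum.swap leaf rest (grown-acyclic t)
    where
    leaf : ∀ {b} → (w , p) ∷ es ∣ w joins b → b ≡ p
    leaf (inj₁ (here refl)) = refl
    leaf (inj₁ (there e∈))  = contradiction (proj₁ (edges⊆vertices t e∈)) w∉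
    leaf (inj₂ (here refl)) = refl
    leaf (inj₂ (there e∈))  = contradiction (proj₂ (edges⊆vertices t e∈)) w∉

    rest : ∀ {a b} → a ≢ w → b ≢ w → (w , p) ∷ es ∣ a joins b → es ∣ a joins b
    rest a≢w b≢w = Sum.map (∈-tail (a≢w ∘ cong proj₁)) (∈-tail (b≢w ∘ cong proj₁))

  module _ {vs es} (t : GrownTree vs es) where

    grownSubgraph : Subgraph G
    grownSubgraph = record
      { vertices = vs
      ; edge     = λ u v → ⌊ joins? es u v ⌋
      ; edge-sym = λ u v → fromWitness {a? = joins? es v u} ∘ Sum.swap ∘ toWitness {a? = joins? es u v}
      ; edge⇒~   = λ u v → [ edges⊆~ t , Graph.sym G v u ∘ edges⊆~ t ]′ ∘ toWitness {a? = joins? es u v}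
      ; edge⇒∈   = λ u v → [ proj₁ ∘ edges⊆vertices t , proj₂ ∘ edges⊆vertices t ]′
                           ∘ toWitness {a? = joins? es u v}
      }

    open Subgraph grownSubgraph using (Edge; IsTree; size; edge)

    Edge⇒joins : ∀ {u v} → Edge u v → es ∣ u joins v
    Edge⇒joins {u} {v} = toWitness {a? = joins? es u v}

    grown-isTree : IsTree
    grown-isTree = grown-nonempty t
      , (λ u v u∈ v∈ → Star.map (λ {a} {b} → fromWitness {a? = joins? es a b}) (grown-connected t u∈ v∈))
      , λ x ys 2≤ u → grown-acyclic t x ys 2≤ u ∘ Linked.map Edge⇒joins

    -- The counted pairs are distinct, and each lies in `es` or in its reversal. The factor two is
    -- harmless, since only some constant bound on the Steiner diameter matters.
    grown-size : size ≤ length es + length es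
    grown-size = subst (size ≤_)
      (trans (length-++ es) (cong (length es +_) (length-map swap es)))
      (unique-⊆⇒length≤ (Unique.filter⁺ counted? pairs-unique) λ {e} e∈ →
        [ ∈-++⁺ˡ , ∈-++⁺ʳ es ∘ ∈-map⁺ swap ]′
          (Edge⇒joins (proj₂ (proj₂ (∈-filter⁻ counted? {v = e} {xs = pairs} e∈)))))
      where
      pairs = cartesianProduct (allFin (order G)) (allFin (order G))
      pairs-unique = Unique.cartesianProduct⁺ (Unique.allFin⁺ (order G)) (Unique.allFin⁺ (order G))
      counted? = λ ((u , v) : V × V) → (u Fin.<? v) ×-dec T? (edge u v)

    -- `κ` colours pairs without a proof of adjacency, so the colours of `es` form a list; its
    -- symmetry handles edges read against their listed direction.
    grown-rainbow : ∀ {m} (c : EdgeColoring G m) (κ : V → V → Fin m) →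
                    (∀ u v → κ u v ≡ κ v u) →
                    (∀ u v p → EdgeColoring.color c u v p ≡ κ u v) →
                    Unique (map (uncurry κ) es) → Rainbow c grownSubgraph
    grown-rainbow c κ κ-sym c≗κ unique u v x y p q eq =
      compare (Edge⇒joins {u} {v} p) (Edge⇒joins {x} {y} q)
        (trans (sym (c≗κ u v _)) (trans eq (c≗κ x y _)))
      where
      same : ∀ {a b a′ b′} → (a , b) ∈ es → (a′ , b′) ∈ es → κ a b ≡ κ a′ b′ → a ≡ a′ × b ≡ b′
      same e f κ≡ = ,-injective (unique-map⇒injectiveOn (uncurry κ) unique e f κ≡)

      compare : es ∣ u joins v → es ∣ x joins y → κ u v ≡ κ x y → (u ≡ x × v ≡ y) ⊎ (u ≡ y × v ≡ x)
      compare (inj₁ e) (inj₁ f) κ≡ = inj₁ (same e f κ≡)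
      compare (inj₁ e) (inj₂ f) κ≡ = inj₂ (same e f (trans κ≡ (κ-sym x y)))
      compare (inj₂ e) (inj₁ f) κ≡ = inj₂ (swap (same e f (trans (κ-sym v u) κ≡)))
      compare (inj₂ e) (inj₂ f) κ≡ = inj₁ (swap (same e f (trans (κ-sym v u) (trans κ≡ (κ-sym x y)))))

  -- A vertex already in the tree adds no edge. In the other case `edges` keeps `v ∉ vs`, from which
  -- the colour of the new edge is computed for complete graphs.
  record Attached (vs : Subset (order G)) (es : List (V × V)) (v p : V) : Set where
    field
      {vs′} : Subset (order G)
      {es′} : List (V × V)
      tree  : GrownTree vs′ es′
      keep  : vs Subset.⊆ vs′
      new   : v Subset.∈ vs′
      edges : es′ ≡ es ⊎ (v Subset.∉ vs × es′ ≡ (v , p) ∷ es)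

  attach : ∀ {vs es v p} → GrownTree vs es → p Subset.∈ vs → (v ≢ p → v ~ p) → Attached vs es v p
  attach {vs} {es} {v} {p} t p∈ v~p with v Subset.∈? vs
  ... | yes v∈ = record { tree = t ; keep = id ; new = v∈ ; edges = inj₁ refl }
  ... | no  v∉ = record
    { tree  = grow t v∉ p∈ (v~p λ { refl → v∉ p∈ })
    ; keep  = λ u∈ → Subset.x∈p∪q⁺ (inj₂ u∈)
    ; new   = Subset.x∈p∪q⁺ (inj₁ (Subset.x∈⁅x⁆ v))
    ; edges = inj₂ (v∉ , refl)
    }

  attached-length : ∀ {vs es v p} (a : Attached vs es v p) → length (Attached.es′ a) ≤ suc (length es)
  attached-length a with Attached.edges a
  ... | inj₁ refl       = ℕ.n≤1+n _
  ... | inj₂ (_ , refl) = ℕ.≤-refl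

-- Complete graphs

-- The first argument is the smaller endpoint. The two path edges precede the clauses that would
-- otherwise catch them; the last clause is the default for edges missing 0, 1 and 2.
palette : ℕ → ℕ → Fin 5
palette 0 1 = 0F
palette 1 2 = 1F
palette 0 _ = 2F
palette 1 _ = 3F
palette 2 _ = 4F
palette _ _ = 0F

hue : ℕ → ℕ → Fin 5
hue x y = palette (x ⊓ y) (x ⊔ y)

hue-sym : ∀ x y → hue x y ≡ hue y x
hue-sym x y = cong₂ palette (ℕ.⊓-comm x y) (ℕ.⊔-comm x y)

-- The vertices 0, 1, 2 span a path whose edges have colours 0 and 1, and the edges
-- from there to the remaining vertices have colours 2, 3 and 4 according to their
-- end on the path, so three further vertices can be hung on three different
-- vertices of the path.
module _ (G : Graph) (complete : ∀ u v → u ≢ v → Graph._~_ G u v) (3≤n : 3 ≤ order G) where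
  private
    V = Vertex G

    anchor : ∀ i → i < 3 → V
    anchor i i<3 = fromℕ< (ℕ.≤-trans i<3 3≤n)

    a₀ = anchor 0 (s≤s z≤n)
    a₁ = anchor 1 (s≤s (s≤s z≤n))
    a₂ = anchor 2 (s≤s (s≤s (s≤s z≤n)))

    toℕ-a₀ : toℕ a₀ ≡ 0
    toℕ-a₀ = Fin.toℕ-fromℕ< _
    toℕ-a₁ : toℕ a₁ ≡ 1
    toℕ-a₁ = Fin.toℕ-fromℕ< _
    toℕ-a₂ : toℕ a₂ ≡ 2
    toℕ-a₂ = Fin.toℕ-fromℕ< _

    κ : V → V → Fin 5
    κ u v = hue (toℕ u) (toℕ v)

  anchorColoring : EdgeColoring G 5
  anchorColoring = record
    { color     = λ u v _ → κ u v
    ; color-sym = λ u v _ _ → hue-sym (toℕ u) (toℕ v)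
    }

  private
    HasAnchors : Subset (order G) → Set
    HasAnchors vs = a₀ Subset.∈ vs × a₁ Subset.∈ vs × a₂ Subset.∈ vs

    ∉-anchors⇒3≤ : ∀ {vs v} → HasAnchors vs → v Subset.∉ vs → 3 ≤ toℕ v
    ∉-anchors⇒3≤ {vs} {v} (a₀∈ , a₁∈ , a₂∈) v∉ with toℕ v in eq
    ... | 0 = contradiction (subst (Subset._∈ vs) (Fin.toℕ-injective (trans toℕ-a₀ (sym eq))) a₀∈) v∉
    ... | 1 = contradiction (subst (Subset._∈ vs) (Fin.toℕ-injective (trans toℕ-a₁ (sym eq))) a₁∈) v∉
    ... | 2 = contradiction (subst (Subset._∈ vs) (Fin.toℕ-injective (trans toℕ-a₂ (sym eq))) a₂∈) v∉
    ... | suc (suc (suc _)) = s≤s (s≤s (s≤s z≤n))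

    hue-0 : ∀ {x y} → 3 ≤ x → y ≡ 0 → toℕ (hue x y) ≡ 2
    hue-0 (s≤s (s≤s (s≤s _))) refl = refl

    hue-1 : ∀ {x y} → 3 ≤ x → y ≡ 1 → toℕ (hue x y) ≡ 3
    hue-1 (s≤s (s≤s (s≤s _))) refl = refl

    hue-2 : ∀ {x y} → 3 ≤ x → y ≡ 2 → toℕ (hue x y) ≡ 4
    hue-2 (s≤s (s≤s (s≤s _))) refl = refl

    -- An invariant for growing rainbow trees: an edge of colour exactly `k` is automatically new,
    -- and the bound becomes `suc k`.
    RainbowBelow : ℕ → List (V × V) → Set
    RainbowBelow k es = All (λ e → toℕ (uncurry κ e) < k) es × Unique (map (uncurry κ) es)

    rainbow-∷ : ∀ {k es v p} → toℕ (κ v p) ≡ k → RainbowBelow k es →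
                RainbowBelow (suc k) ((v , p) ∷ es)
    rainbow-∷ refl (below , unique) =
      ℕ.≤-refl ∷ All.map ℕ.m≤n⇒m≤1+n below ,
      AllP.map⁺ (All.map (λ lt eq → ℕ.<⇒≢ lt (cong toℕ (sym eq))) below) ∷ unique

    -- The bound is raised even if no edge is added, so the next attachment can rely on its own
    -- fixed colour.
    rainbow-attached : ∀ {k vs es v p} (a : Attached G vs es v p) →
                       (v Subset.∉ vs → toℕ (κ v p) ≡ k) →
                       RainbowBelow k es → RainbowBelow (suc k) (Attached.es′ a)
    rainbow-attached a κ≡k rb with Attached.edges a
    ... | inj₁ refl        = All.map ℕ.m≤n⇒m≤1+n (proj₁ rb) , proj₂ rb
    ... | inj₂ (v∉ , refl) = rainbow-∷ (κ≡k v∉) rb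

  anchorColoring-rainbow : IsRainbowColoring 3 anchorColoring
  anchorColoring-rainbow S ∣S∣≡3 with x , y , z , cover ← ∣p∣≡3⇒covered S ∣S∣≡3 =
    grownSubgraph G (tree A₃)
    , (grown-isTree G (tree A₃) , λ u∈S → covered (cover u∈S))
    , grown-rainbow G (tree A₃) anchorColoring κ (λ u v → hue-sym (toℕ u) (toℕ v)) (λ _ _ _ → refl)
        (proj₂ rb₃)
    where
    open Attached
    a₁≢a₀ : a₁ ≢ a₀
    a₁≢a₀ = fromℕ<-distinct (λ ()) _ _
    a₂≢a₁ : a₂ ≢ a₁
    a₂≢a₁ = fromℕ<-distinct (λ ()) _ _
    a₂≢a₀ : a₂ ≢ a₀
    a₂≢a₀ = fromℕ<-distinct (λ ()) _ _

    -- Grown from `a₀`, so that the colours 0 and 1 appear in the increasing order that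
    -- `RainbowBelow` tracks.
    path : GrownTree G (⁅ a₂ ⁆ ∪ (⁅ a₁ ⁆ ∪ ⁅ a₀ ⁆)) ((a₂ , a₁) ∷ (a₁ , a₀) ∷ [])
    path = grow (grow (root a₀) (a₁≢a₀ ∘ Subset.x∈⁅y⁆⇒x≡y a₀) (Subset.x∈⁅x⁆ a₀) (complete _ _ a₁≢a₀))
      (λ a₂∈ → [ a₂≢a₁ ∘ Subset.x∈⁅y⁆⇒x≡y a₁ , a₂≢a₀ ∘ Subset.x∈⁅y⁆⇒x≡y a₀ ]′ (Subset.x∈p∪q⁻ _ _ a₂∈))
      (Subset.x∈p∪q⁺ (inj₁ (Subset.x∈⁅x⁆ a₁))) (complete _ _ a₂≢a₁)

    anchors₀ : HasAnchors (⁅ a₂ ⁆ ∪ (⁅ a₁ ⁆ ∪ ⁅ a₀ ⁆))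
    anchors₀ = Subset.x∈p∪q⁺ (inj₂ (Subset.x∈p∪q⁺ (inj₂ (Subset.x∈⁅x⁆ a₀))))
             , Subset.x∈p∪q⁺ (inj₂ (Subset.x∈p∪q⁺ (inj₁ (Subset.x∈⁅x⁆ a₁))))
             , Subset.x∈p∪q⁺ (inj₁ (Subset.x∈⁅x⁆ a₂))

    rb₀ : RainbowBelow 2 ((a₂ , a₁) ∷ (a₁ , a₀) ∷ [])
    rb₀ = rainbow-∷ (cong₂ (λ i j → toℕ (hue i j)) toℕ-a₂ toℕ-a₁)
         (rainbow-∷ (cong₂ (λ i j → toℕ (hue i j)) toℕ-a₁ toℕ-a₀) ([] , []))

    keep-anchors : ∀ {vs es v p} (a : Attached G vs es v p) → HasAnchors vs → HasAnchors (vs′ a)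
    keep-anchors a (∈₀ , ∈₁ , ∈₂) = keep a ∈₀ , keep a ∈₁ , keep a ∈₂

    -- Hanging `x`, `y`, `z` on `a₀`, `a₁`, `a₂` in turn costs the colours 2, 3, 4, in step with the
    -- bounds 2, 3, 4 of the invariant.
    A₁ = attach G path (proj₁ anchors₀) (complete x a₀)
    anchors₁ = keep-anchors A₁ anchors₀
    rb₁ = rainbow-attached A₁ (λ x∉ → hue-0 (∉-anchors⇒3≤ anchors₀ x∉) toℕ-a₀) rb₀

    A₂ = attach G (tree A₁) (proj₁ (proj₂ anchors₁)) (complete y a₁)
    anchors₂ = keep-anchors A₂ anchors₁
    rb₂ = rainbow-attached A₂ (λ y∉ → hue-1 (∉-anchors⇒3≤ anchors₁ y∉) toℕ-a₁) rb₁

    A₃ = attach G (tree A₂) (proj₂ (proj₂ anchors₂)) (complete z a₂)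
    rb₃ = rainbow-attached A₃ (λ z∉ → hue-2 (∉-anchors⇒3≤ anchors₂ z∉) toℕ-a₂) rb₂

    covered : ∀ {u} → u ∈ x ∷ y ∷ z ∷ [] → u Subset.∈ vs′ A₃
    covered (here refl)                 = keep A₃ (keep A₂ (new A₁))
    covered (there (here refl))         = keep A₃ (new A₂)
    covered (there (there (here refl))) = new A₃

-- Induction on a walk from `u` to `v` with first step `w`: by induction `w ~ v` unless `w ≡ v`, and
-- then `u`, `w`, `v` would induce a `Path 3` if `u` and `v` were not adjacent.
P₃-free⇒complete : (G : Graph) → Connected G → Path 3 -Free G →
                   ∀ u v → u ≢ v → Graph._~_ G u v
P₃-free⇒complete G (_ , connected) free u v u≢v = adjacent u≢v (connected u v)
  where
  open Graph G using (_~_)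

  adjacent : ∀ {u v} → u ≢ v → Star _~_ u v → u ~ v
  adjacent u≢v ε = contradiction refl u≢v
  adjacent {u} {v} u≢v (_◅_ {j = w} u~w walk) with w Fin.≟ v | T? (Graph.adj G u v)
  ... | yes refl | _       = u~w
  ... | no _     | yes u~v = u~v
  ... | no w≢v   | no u≁v  = ⊥-elim (free (f , f-injective , f-induced))
    where
    w~v = adjacent w≢v walk

    f : Fin 3 → Vertex G
    f zero             = u
    f (suc zero)       = w
    f (suc (suc zero)) = v

    u≢w : u ≢ w
    u≢w refl = Graph.irrefl G u u~w

    f-injective : ∀ {i j} → f i ≡ f j → i ≡ j
    f-injective {zero}             {zero}             _  = refl
    f-injective {zero}             {suc zero}         eq = contradiction eq u≢w
    f-injective {zero}             {suc (suc zero)}   eq = contradiction eq u≢v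
    f-injective {suc zero}         {zero}             eq = contradiction (sym eq) u≢w
    f-injective {suc zero}         {suc zero}         _  = refl
    f-injective {suc zero}         {suc (suc zero)}   eq = contradiction eq w≢v
    f-injective {suc (suc zero)}   {zero}             eq = contradiction (sym eq) u≢v
    f-injective {suc (suc zero)}   {suc zero}         eq = contradiction (sym eq) w≢v
    f-injective {suc (suc zero)}   {suc (suc zero)}   _  = refl

    f-induced : ∀ i j → Graph._~_ (Path 3) i j ⇔ f i ~ f j
    f-induced zero             zero             = mk⇔ (λ ()) (Graph.irrefl G u)
    f-induced zero             (suc zero)       = mk⇔ (const u~w) _
    f-induced zero             (suc (suc zero)) = mk⇔ (λ ()) u≁v
    f-induced (suc zero)       zero             = mk⇔ (const (Graph.sym G u w u~w)) _
    f-induced (suc zero)       (suc zero)       = mk⇔ (λ ()) (Graph.irrefl G w)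
    f-induced (suc zero)       (suc (suc zero)) = mk⇔ (const w~v) _
    f-induced (suc (suc zero)) zero             = mk⇔ (λ ()) (u≁v ∘ Graph.sym G v u)
    f-induced (suc (suc zero)) (suc zero)       = mk⇔ (const (Graph.sym G w v w~v)) _
    f-induced (suc (suc zero)) (suc (suc zero)) = mk⇔ (λ ()) (Graph.irrefl G v)

≅⇒containsInduced : ∀ X Y G → X ≅ Y → ContainsInduced G Y → ContainsInduced G X
≅⇒containsInduced X Y G (φ , φ-adj) (f , f-injective , f-induced) =
  f ∘ to , Injection.injective (↔⇒↣ φ) ∘ f-injective ,
  λ u v → f-induced (to u) (to v) ⇔-∘ φ-adj u v
  where open Inverse φ using (to)

-- Graphs with a clique of hubs and graphs with pendant vertices

module _ (G : Graph) (hub : Vertex G → Vertex G)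
         (near : ∀ v → v ≢ hub v → Graph._~_ G v (hub v))
         (clique : ∀ u v → hub u ≢ hub v → Graph._~_ G (hub u) (hub v)) where

  hub-connected : ∀ u v → Star (Graph._~_ G) u v
  hub-connected u v = step (near u) ◅◅ step (clique u v) ◅◅ Star.reverse (Graph.sym G _ _) (step (near v))
    where
    step : ∀ {a b} → (a ≢ b → Graph._~_ G a b) → Star (Graph._~_ G) a b
    step {a} {b} a~b with a Fin.≟ b
    ... | yes refl = ε
    ... | no  a≢b  = a~b a≢b ◅ ε

  -- Starting from `hub x`, at most five vertices are attached: `x`, `hub y`, `y`, `hub z`, `z`. The
  -- doubling in `grown-size` turns five edges into the bound 10.
  hub-tree : ∀ S → ∣ S ∣ ≡ 3 → ∃ λ H → IsSTree G S H × Subgraph.size H ≤ 10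
  hub-tree S ∣S∣≡3 with x , y , z , cover ← ∣p∣≡3⇒covered S ∣S∣≡3 =
    grownSubgraph G (tree A₅) , (grown-isTree G (tree A₅) , λ u∈S → covered (cover u∈S)) ,
    ℕ.≤-trans (grown-size G (tree A₅)) (ℕ.+-mono-≤ length≤5 length≤5)
    where
    open Attached
    A₁ = attach G (root (hub x)) (Subset.x∈⁅x⁆ (hub x)) (near x)
    hub∈ = keep A₁ (Subset.x∈⁅x⁆ (hub x))
    A₂ = attach G (tree A₁) hub∈ (clique y x)
    A₃ = attach G (tree A₂) (new A₂) (near y)
    A₄ = attach G (tree A₃) (keep A₃ (keep A₂ hub∈)) (clique z x)
    A₅ = attach G (tree A₄) (new A₄) (near z)

    covered : ∀ {u} → u ∈ x ∷ y ∷ z ∷ [] → u Subset.∈ vs′ A₅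
    covered (here refl)                 = keep A₅ (keep A₄ (keep A₃ (keep A₂ (new A₁))))
    covered (there (here refl))         = keep A₅ (keep A₄ (new A₃))
    covered (there (there (here refl))) = new A₅

    length≤5 : length (es′ A₅) ≤ 5
    length≤5 = ℕ.≤-trans (attached-length G A₅) (s≤s (ℕ.≤-trans (attached-length G A₄)
      (s≤s (ℕ.≤-trans (attached-length G A₃) (s≤s (ℕ.≤-trans (attached-length G A₂)
      (s≤s (attached-length G A₁))))))))

-- Existence of the rainbow index and the Steiner diameter.

module _ {n : ℕ} where

  -- An injective code for unordered pairs, with the smaller end first. Used as a colouring, it
  -- makes every tree rainbow.
  edgeCode : Fin n → Fin n → Fin (n * n)
  edgeCode u v with u Fin.<? v
  ... | yes _ = combine u v
  ... | no  _ = combine v u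

  edgeCode-sym : ∀ u v → edgeCode u v ≡ edgeCode v u
  edgeCode-sym u v with u Fin.<? v | v Fin.<? u
  ... | yes u<v | yes v<u = contradiction v<u (ℕ.<-asym u<v)
  ... | yes _   | no  _   = refl
  ... | no  _   | yes _   = refl
  ... | no  u≮v | no  v≮u
    with refl ← Fin.toℕ-injective (ℕ.≤-antisym (ℕ.≮⇒≥ v≮u) (ℕ.≮⇒≥ u≮v)) = refl

  edgeCode-injective : ∀ u v x y → edgeCode u v ≡ edgeCode x y →
                       (u ≡ x × v ≡ y) ⊎ (u ≡ y × v ≡ x)
  edgeCode-injective u v x y eq with u Fin.<? v | x Fin.<? y
  ... | yes _ | yes _ = inj₁ (Fin.combine-injective u v x y eq)
  ... | yes _ | no  _ = inj₂ (Fin.combine-injective u v y x eq)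
  ... | no  _ | yes _ = inj₂ (swap (Fin.combine-injective v u x y eq))
  ... | no  _ | no  _ = inj₁ (swap (Fin.combine-injective v u y x eq))

module _ (G : Graph) (b : ℕ)
         (trees : ∀ S → ∣ S ∣ ≡ 3 → ∃ λ H → IsSTree G S H × Subgraph.size H ≤ b) where

  ¬¬-rainbowIndex : ¬ ¬ ∃ (IsRainbowIndex 3 G)
  ¬¬-rainbowIndex = ¬¬-minimum _ {order G * order G} (codeColoring , λ S ∣S∣≡3 →
    let H , isSTree , _ = trees S ∣S∣≡3 in
    H , isSTree , λ u v x y _ _ → edgeCode-injective u v x y)
    where
    codeColoring : EdgeColoring G (order G * order G)
    codeColoring = record { color = λ u v _ → edgeCode u v ; color-sym = λ u v _ _ → edgeCode-sym u v }

  private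
    SteinerDistance : ℕ → Set
    SteinerDistance d = ∃ λ (S : Subset (order G)) → ∣ S ∣ ≡ 3 × IsSteinerDistance G S d

    steinerDistance≤ : ∀ d → SteinerDistance d → d ≤ b
    steinerDistance≤ d (S , ∣S∣≡3 , _ , minimal) =
      let H , isSTree , size≤b = trees S ∣S∣≡3 in
      ℕ.≤-trans (minimal _ (H , isSTree , refl)) size≤b

  steinerDiameter≤ : ∀ {s} → IsSteinerDiameter 3 G s → s ≤ b
  steinerDiameter≤ (distance , _) = steinerDistance≤ _ distance

  -- Two extrema are nested: the given tree for `S` yields a minimal size, so some Steiner distance
  -- exists, and all of them are bounded by `b`.
  ¬¬-steinerDiameter : ∀ S → ∣ S ∣ ≡ 3 → ¬ ¬ ∃ (IsSteinerDiameter 3 G)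
  ¬¬-steinerDiameter S ∣S∣≡3 none =
    let H , isSTree , _ = trees S ∣S∣≡3 in
    ¬¬-minimum _ (H , isSTree , refl) λ (d , distance) →
    ¬¬-maximum SteinerDistance b steinerDistance≤ (S , ∣S∣≡3 , distance) none

-- Pendant edges under rainbow colourings.

module _ (G : Graph) {n : ℕ} (leaf stem : Fin n → Vertex G)
         (leaf-injective : ∀ {i j} → leaf i ≡ leaf j → i ≡ j)
         (leaf≢stem : ∀ i j → leaf i ≢ stem j)
         (leaf~stem : ∀ i → Graph._~_ G (leaf i) (stem i))
         (leaf-degree : ∀ i {w} → Graph._~_ G (leaf i) w → w ≡ stem i) where

  -- A tree through two leaves must leave each of them by its only edge, so it contains both pendant
  -- edges and their colours differ. Hence colouring the pendant edges is injective.
  pendants≤colors : ∀ {m} (c : EdgeColoring G m) → IsRainbowColoring 3 c → n ≤ m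
  pendants≤colors c rainbow = Fin.injective⇒≤ {f = λ i → color (leaf i) (stem i) (leaf~stem i)} injective
    where
    open EdgeColoring c

    injective : ∀ {i j} → color (leaf i) (stem i) (leaf~stem i) ≡ color (leaf j) (stem j) (leaf~stem j) → i ≡ j
    injective {i} {j} eq with i Fin.≟ j
    ... | yes i≡j = i≡j
    ... | no  i≢j with H , ((_ , connected , _) , S⊆) , distinct ←
                         -- The stem pads the two leaves to a set of three vertices.
                         rainbow (triple (leaf i) (leaf j) (stem i))
                           (∣triple∣≡3 (i≢j ∘ leaf-injective) (leaf≢stem i i) (leaf≢stem j i)) =
      [ leaf-injective ∘ proj₁ , (λ (li≡sj , _) → contradiction li≡sj (leaf≢stem i j)) ]′
        (distinct _ _ _ _ (pendant i≢j i∈ j∈) (pendant (i≢j ∘ sym) j∈ i∈)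
          -- Colours take an adjacency proof as argument; the one stored in the subgraph is
          -- identified with `leaf~stem`.
          (subst₂ (λ p q → color _ _ p ≡ color _ _ q) (T-irrelevant _ _) (T-irrelevant _ _) eq))
      where
      open Subgraph H
      i∈ : leaf i Subset.∈ vertices
      i∈ = S⊆ (Subset.x∈p∪q⁺ (inj₁ (Subset.x∈⁅x⁆ _)))
      j∈ : leaf j Subset.∈ vertices
      j∈ = S⊆ (Subset.x∈p∪q⁺ (inj₂ (Subset.x∈p∪q⁺ (inj₁ (Subset.x∈⁅x⁆ _)))))

      pendant : ∀ {a b} → a ≢ b → leaf a Subset.∈ vertices → leaf b Subset.∈ vertices → Edge (leaf a) (stem a)
      pendant {a} {b} a≢b a∈ b∈ = first refl (connected (leaf a) (leaf b) a∈ b∈)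
        where
        first : ∀ {u} → u ≡ leaf a → Star Edge u (leaf b) → Edge (leaf a) (stem a)
        first u≡ ε = contradiction (leaf-injective (sym u≡)) a≢b
        first refl (e ◅ _) = subst (Edge (leaf a)) (leaf-degree a (edge⇒~ _ _ e)) e

-- Thorny cliques

-- Thorn `a` hangs on the clique vertex `π a`. One construction thus gives both the stars (`k` equal
-- to 1) and the coronas of complete graphs (`π` the identity).
module _ {k n : ℕ} (π : Fin n → Fin k) where

  thornyAdj : Fin k ⊎ Fin n → Fin k ⊎ Fin n → Bool
  thornyAdj (inj₁ i) (inj₁ j) = ⌊ ¬? (i Fin.≟ j) ⌋
  thornyAdj (inj₁ i) (inj₂ a) = ⌊ i Fin.≟ π a ⌋
  thornyAdj (inj₂ a) (inj₁ i) = ⌊ i Fin.≟ π a ⌋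
  thornyAdj (inj₂ a) (inj₂ b) = false

  thornyAdj-sym : ∀ x y → T (thornyAdj x y) → T (thornyAdj y x)
  thornyAdj-sym (inj₁ i) (inj₁ j) p =
    fromWitness {a? = ¬? (j Fin.≟ i)} (toWitness {a? = ¬? (i Fin.≟ j)} p ∘ sym)
  thornyAdj-sym (inj₁ i) (inj₂ a) p = p
  thornyAdj-sym (inj₂ a) (inj₁ i) p = p

  thornyAdj-irrefl : ∀ x → ¬ T (thornyAdj x x)
  thornyAdj-irrefl (inj₁ i) p = toWitness {a? = ¬? (i Fin.≟ i)} p refl

  ThornyClique : Graph
  ThornyClique = record
    { order  = k + n
    ; adj    = λ u v → thornyAdj (splitAt k u) (splitAt k v)
    ; sym    = λ u v → thornyAdj-sym (splitAt k u) (splitAt k v)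
    ; irrefl = λ v → thornyAdj-irrefl (splitAt k v)
    }

  open Graph ThornyClique using (_~_)

  core : Fin k → Vertex ThornyClique
  core i = i ↑ˡ n

  thorn : Fin n → Vertex ThornyClique
  thorn a = k ↑ʳ a

  data Kind : Vertex ThornyClique → Set where
    isCore  : ∀ i → Kind (core i)
    isThorn : ∀ a → Kind (thorn a)

  kind : ∀ v → Kind v
  kind v with splitAt k v | Fin.join-splitAt k n v
  ... | inj₁ i | refl = isCore i
  ... | inj₂ a | refl = isThorn a

  core~core : ∀ {i j} → i ≢ j → core i ~ core j
  core~core {i} {j} i≢j rewrite Fin.splitAt-↑ˡ k i n | Fin.splitAt-↑ˡ k j n =
    fromWitness {a? = ¬? (i Fin.≟ j)} i≢j

  thorn~core : ∀ a → thorn a ~ core (π a)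
  thorn~core a rewrite Fin.splitAt-↑ʳ k n a | Fin.splitAt-↑ˡ k (π a) n =
    fromWitness {a? = π a Fin.≟ π a} refl

  thorn~⇒core : ∀ a {w} → thorn a ~ w → w ≡ core (π a)
  thorn~⇒core a {w} a~w with kind w
  thorn~⇒core a a~w | isCore i rewrite Fin.splitAt-↑ʳ k n a | Fin.splitAt-↑ˡ k i n =
    cong (_↑ˡ n) (toWitness {a? = i Fin.≟ π a} a~w)
  thorn~⇒core a a~w | isThorn b rewrite Fin.splitAt-↑ʳ k n a | Fin.splitAt-↑ʳ k n b = ⊥-elim a~w

  thorn≢core : ∀ a i → thorn a ≢ core i
  thorn≢core a i eq with () ← trans (sym (Fin.splitAt-↑ʳ k n a))
                                (trans (cong (splitAt k) eq) (Fin.splitAt-↑ˡ k i n))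

  foot : Vertex ThornyClique → Fin k
  foot v = [ id , π ]′ (splitAt k v)

  near-foot : ∀ v → v ≢ core (foot v) → v ~ core (foot v)
  near-foot v v≢ with kind v
  ... | isCore i  rewrite Fin.splitAt-↑ˡ k i n = contradiction refl v≢
  ... | isThorn a = subst (λ x → thorn a ~ core ([ id , π ]′ x)) (sym (Fin.splitAt-↑ʳ k n a)) (thorn~core a)

  thorny-trees : ∀ S → ∣ S ∣ ≡ 3 → ∃ λ H → IsSTree ThornyClique S H × Subgraph.size H ≤ 10
  thorny-trees = hub-tree ThornyClique (core ∘ foot) near-foot λ u v ≢ → core~core (≢ ∘ cong core)

  thorny-connected : 1 ≤ k → Connected ThornyClique
  thorny-connected 1≤k = core (fromℕ< 1≤k) ,
    hub-connected ThornyClique (core ∘ foot) near-foot λ u v ≢ → core~core (≢ ∘ cong core)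

  thorny-index : ∀ {r} → IsRainbowIndex 3 ThornyClique r → n ≤ r
  thorny-index ((c , rainbow) , _) =
    pendants≤colors ThornyClique thorn (core ∘ π) (Fin.↑ʳ-injective k _ _)
      (λ a b → thorn≢core a (π b)) thorn~core thorn~⇒core c rainbow

  -- Were the graph `X`-free, then `r ≤ s + C ≤ 10 + C < n ≤ r`. The conclusion is doubly negated
  -- because `r` and `s` are obtained only up to double negation.
  thorny-unavoidable : ∀ X C → 1 ≤ k → 11 + C ≤ n →
    ((G : Graph) → Connected G → 3 ≤ order G → X -Free G →
      (r s : ℕ) → IsRainbowIndex 3 G r → IsSteinerDiameter 3 G s → r ≤ s + C) →
    ¬ ¬ ContainsInduced ThornyClique X
  thorny-unavoidable X C 1≤k 11+C≤n bound free =
    ¬¬-rainbowIndex ThornyClique 10 thorny-trees λ (r , rx) →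
    ¬¬-steinerDiameter ThornyClique 10 thorny-trees S₀ ∣S₀∣≡3 λ (s , sdiam) →
    ℕ.<⇒≱ (ℕ.≤-trans (s≤s (ℕ.+-monoˡ-≤ C (steinerDiameter≤ ThornyClique 10 thorny-trees sdiam)))
             (ℕ.≤-trans 11+C≤n (thorny-index rx)))
      (bound ThornyClique (thorny-connected 1≤k) 3≤order free r s rx sdiam)
    where
    2≤n : 2 ≤ n
    2≤n = ℕ.≤-trans (s≤s (s≤s z≤n)) 11+C≤n

    3≤order : 3 ≤ k + n
    3≤order = ℕ.+-mono-≤ 1≤k 2≤n

    t₀ t₁ : Fin n
    t₀ = fromℕ< (ℕ.≤-trans (s≤s z≤n) 2≤n)
    t₁ = fromℕ< 2≤n

    S₀ : Subset (k + n)
    -- Some set of three vertices must be exhibited for the Steiner diameter to exist.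
    S₀ = triple (thorn t₀) (thorn t₁) (core (fromℕ< 1≤k))

    ∣S₀∣≡3 : ∣ S₀ ∣ ≡ 3
    ∣S₀∣≡3 = ∣triple∣≡3
      (fromℕ<-distinct (λ ()) _ _ ∘ Fin.↑ʳ-injective k t₀ t₁)
      (thorn≢core _ _) (thorn≢core _ _)

  module _ (π-injective : ∀ {a b} → π a ≡ π b → a ≡ b) where

    thorn-unique : ∀ {a b c} → thorn a ~ c → thorn b ~ c → thorn a ≡ thorn b
    thorn-unique a~c b~c = cong thorn (π-injective (Fin.↑ˡ-injective n _ _
      (trans (sym (thorn~⇒core _ a~c)) (thorn~⇒core _ b~c))))

    -- Two of three neighbours of `c` are of the same kind. Two clique vertices are adjacent, and
    -- two thorns at `c` coincide because `π` is injective.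
    thorny-claw-free : ∀ {c x y z} → x ~ c → y ~ c → z ~ c →
                       x ≢ y → x ≢ z → y ≢ z → ¬ x ~ y → ¬ x ~ z → ¬ y ~ z → ⊥
    thorny-claw-free {c} {x} {y} {z} x~c y~c z~c x≢y x≢z y≢z x≁y x≁z y≁z
      with kind x | kind y | kind z
    ... | isCore i  | isCore j  | _         = x≁y (core~core (x≢y ∘ cong core))
    ... | isCore i  | isThorn b | isCore l  = x≁z (core~core (x≢z ∘ cong core))
    ... | isThorn a | isCore j  | isCore l  = y≁z (core~core (y≢z ∘ cong core))
    ... | isThorn a | isThorn b | _         = x≢y (thorn-unique x~c y~c)
    ... | isThorn a | isCore j  | isThorn b = x≢z (thorn-unique x~c z~c)
    ... | isCore i  | isThorn a | isThorn b = y≢z (thorn-unique y~c z~c)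

-- Stars

IsCenter : (X : Graph) → Vertex X → Set
IsCenter X c = (∀ u → u ≢ c → u ~ c) × (∀ u v → u ~ v → u ≡ c ⊎ v ≡ c)
  where open Graph X using (_~_)

-- Decidability lets a doubly negated embedding into a star produce an actual centre.
isCenter? : ∀ X c → Dec (IsCenter X c)
isCenter? X c =
  Fin.all? (λ u → ¬? (u Fin.≟ c) →-dec T? (adj u c)) ×-dec
  Fin.all? (λ u → Fin.all? λ v → T? (adj u v) →-dec (u Fin.≟ c ⊎-dec v Fin.≟ c))
  where open Graph X using (adj)

-- Every edge of a star is a spoke, and injectivity keeps the image of its outer end away from `d`,
-- so the image is again a spoke.
center-mono : ∀ X Y {c d} → IsCenter X c → IsCenter Y d →
              (f : Vertex X → Vertex Y) → (∀ {u v} → f u ≡ f v → u ≡ v) → f c ≡ d →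
              ∀ u v → Graph._~_ X u v → Graph._~_ Y (f u) (f v)
center-mono X Y (_ , meets) (spans , _) f f-injective refl u v u~v with meets u v u~v
... | inj₂ refl = spans (f u) λ fu≡fv → case f-injective fu≡fv of λ { refl → Graph.irrefl X u u~v }
... | inj₁ refl = Graph.sym Y _ _
  (spans (f v) λ fv≡fu → case f-injective fv≡fu of λ { refl → Graph.irrefl X u u~v })

center-≅ : ∀ X Y {c d} → IsCenter X c → IsCenter Y d →
           (φ : Vertex X ↔ Vertex Y) → Inverse.to φ c ≡ d → X ≅ Y
center-≅ X Y {c} X-center Y-center φ φc≡d = φ , λ u v → mk⇔
  (center-mono X Y X-center Y-center to (Injection.injective (↔⇒↣ φ)) φc≡d u v)
  (subst₂ (Graph._~_ X) (strictlyInverseʳ u) (strictlyInverseʳ v) ∘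
    center-mono Y X Y-center X-center from (Injection.injective (↔⇒↣ (↔-sym φ)))
      (trans (cong from (sym φc≡d)) (strictlyInverseʳ c)) (to u) (to v))
  where open Inverse φ

Path3-center : IsCenter (Path 3) 1F
Path3-center = toWitness {a? = isCenter? (Path 3) 1F} _

-- Any bijection taking centre to centre is an isomorphism of stars; the transposition of `c` with
-- the middle vertex is one.
center⇒≅Path3 : (X : Graph) → order X ≡ 3 → ∀ {c} → IsCenter X c → X ≅ Path 3
center⇒≅Path3 X@record { order = .3 } refl {c} center =
  center-≅ X (Path 3) center Path3-center (transpose c 1F) (transpose-center c)
  where
  transpose-center : ∀ c → transpose c 1F ⟨$⟩ʳ c ≡ 1F
  transpose-center 0F = refl
  transpose-center 1F = refl
  transpose-center 2F = refl

StarGraph : ℕ → Graph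
StarGraph n = ThornyClique {1} {n} (const 0F)

connected⇒edge : (X : Graph) → Connected X → 3 ≤ order X → ∃ λ u → ∃ λ v → Graph._~_ X u v
connected⇒edge X (_ , connected) 3≤ = first u≢v (connected u v)
  where
  u = fromℕ< (ℕ.≤-trans (s≤s z≤n) 3≤)
  v = fromℕ< (ℕ.≤-trans (s≤s (s≤s z≤n)) 3≤)

  u≢v : u ≢ v
  u≢v = fromℕ<-distinct (λ ()) _ _

  first : ∀ {a b} → a ≢ b → Star (Graph._~_ X) a b → ∃ λ u → ∃ λ v → Graph._~_ X u v
  first a≢b ε       = contradiction refl a≢b
  first a≢b (e ◅ _) = _ , _ , e

-- An edge of `X` forces the embedding to hit the hub `o` of the star, and the vertex mapped to `o`
-- inherits the role of centre.
induced-in-star⇒center : ∀ n X → Connected X → 3 ≤ order X →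
                         ContainsInduced (StarGraph n) X → ∃ (IsCenter X)
induced-in-star⇒center n X connected 3≤ (f , f-injective , f-induced)
  with u , v , u~v ← connected⇒edge X connected 3≤ =
  [ (λ fu≡o → u , isCenter fu≡o) , (λ fv≡o → v , isCenter fv≡o) ]′
    (star-edge (Equivalence.to (f-induced u v) u~v))
  where
  open Graph (StarGraph n) using (_~_)
  π : Fin n → Fin 1
  π = const 0F
  o = core {1} {n} π 0F

  star-edge : ∀ {x y} → x ~ y → x ≡ o ⊎ y ≡ o
  star-edge {x} x~y with kind {1} {n} π x
  ... | isCore 0F = inj₁ refl
  ... | isThorn a = inj₂ (thorn~⇒core π a x~y)

  star-spoke : ∀ x → x ≢ o → x ~ o
  star-spoke x x≢o with kind {1} {n} π x
  ... | isCore 0F = contradiction refl x≢o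
  ... | isThorn a = thorn~core π a

  isCenter : ∀ {c} → f c ≡ o → IsCenter X c
  isCenter {c} fc≡o =
    (λ u u≢c → Equivalence.from (f-induced u c)
      (subst (f u ~_) (sym fc≡o) (star-spoke (f u) λ fu≡o → u≢c (f-injective (trans fu≡o (sym fc≡o)))))) ,
    λ u v u~v → Sum.map (λ fu≡o → f-injective (trans fu≡o (sym fc≡o)))
                        (λ fv≡o → f-injective (trans fv≡o (sym fc≡o)))
                        (star-edge (Equivalence.to (f-induced u v) u~v))

three-others : ∀ {N} → 4 ≤ N → (c : Fin N) →
               ∃ λ (g : Fin 3 → Fin N) → (∀ {i j} → g i ≡ g j → i ≡ j) × (∀ i → g i ≢ c)
three-others {suc (suc (suc (suc m)))} (s≤s (s≤s (s≤s (s≤s _)))) c =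
  (λ i → punchIn c (i ↑ˡ m)) ,
  (λ eq → Fin.↑ˡ-injective m _ _ (Fin.punchIn-injective c _ _ eq)) ,
  λ i → Fin.punchInᵢ≢i c (i ↑ˡ m)

-- With four or more vertices, the centre and three others would form an induced claw, which the
-- corona excludes.
induced-in-corona⇒order≤3 : ∀ n X {c} → IsCenter X c →
                            ContainsInduced (ThornyClique {n} id) X → order X ≤ 3
induced-in-corona⇒order≤3 n X {c} (spans , meets) (f , f-injective , f-induced) = ℕ.≮⇒≥ λ 4≤ →
  let g , g-injective , g≢c = three-others 4≤ c
      spoke : ∀ i → f (g i) ~ f c
      spoke i = Equivalence.to (f-induced (g i) c) (spans (g i) (g≢c i))
      apart : ∀ {i j} → i ≢ j → f (g i) ≢ f (g j)
      apart i≢j eq = i≢j (g-injective (f-injective eq))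
      independent : ∀ i j → ¬ f (g i) ~ f (g j)
      independent i j e = [ g≢c i , g≢c j ]′ (meets (g i) (g j) (Equivalence.from (f-induced (g i) (g j)) e))
  in thorny-claw-free {n} {n} id id {f c} {f (g 0F)} {f (g 1F)} {f (g 2F)}
        (spoke 0F) (spoke 1F) (spoke 2F)
       (apart λ ()) (apart λ ()) (apart λ ())
       (independent 0F 1F) (independent 0F 2F) (independent 1F 2F)
  where open Graph (ThornyClique {n} id) using (_~_)

theorem5 : (X : Graph) → Connected X → 3 ≤ order X →
    (∃ λ (C : ℕ) → (G : Graph) → Connected G → 3 ≤ order G → X -Free G →
    (r s : ℕ) → IsRainbowIndex 3 G r → IsSteinerDiameter 3 G s → r ≤ s + C)
    ⇔ (X ≅ Path 3)
theorem5 X connected 3≤ = mk⇔ bounded⇒P₃ P₃⇒bounded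
  where
  bounded⇒P₃ : (∃ λ C → (G : Graph) → Connected G → 3 ≤ order G → X -Free G →
    (r s : ℕ) → IsRainbowIndex 3 G r → IsSteinerDiameter 3 G s → r ≤ s + C) → X ≅ Path 3
  bounded⇒P₃ (C , bound) = center⇒≅Path3 X (ℕ.≤-antisym order≤3 3≤) (proj₂ center)
    where
    center : ∃ (IsCenter X)
    center = decidable-stable (Fin.any? (isCenter? X)) λ none →
      -- The star with `11 + C` leaves, just enough thorns to exceed the bound 10 on the Steiner
      -- diameter by more than `C`.
      thorny-unavoidable {1} {11 + C} (const 0F) X C (s≤s z≤n) ℕ.≤-refl bound λ emb →
      none (induced-in-star⇒center (11 + C) X connected 3≤ emb)

    order≤3 : order X ≤ 3
    order≤3 = decidable-stable (order X ℕ.≤? 3) λ order≰3 →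
      -- The corona with the same number of thorns, one at each clique vertex.
      thorny-unavoidable {11 + C} {11 + C} id X C (s≤s z≤n) ℕ.≤-refl bound λ emb →
      order≰3 (induced-in-corona⇒order≤3 (11 + C) X (proj₂ center) emb)

  P₃⇒bounded : X ≅ Path 3 → ∃ λ C → (G : Graph) → Connected G → 3 ≤ order G → X -Free G →
    (r s : ℕ) → IsRainbowIndex 3 G r → IsSteinerDiameter 3 G s → r ≤ s + C
  -- The constant is the size of the palette: five colours suffice, and `5 ≤ s + 5` for every `s`.
  P₃⇒bounded X≅P₃ = 5 , λ G G-connected 3≤G free r s rx _ →
    let complete = P₃-free⇒complete G G-connected (free ∘ ≅⇒containsInduced X (Path 3) G X≅P₃) in
    ℕ.≤-trans (proj₂ rx 5 (anchorColoring G complete 3≤G , anchorColoring-rainbow G complete 3≤G))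
      (ℕ.m≤n+m 5 s)
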